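{- Let $q$ be a power of $2$ and let $r,s$ be positive integers with $s\equiv r+2q\pmod{q+1}$. Let $B(x)\in\mathbb{F}_{q^2}[x]$ be such that $B(x)$ has no root in $\mu_{q+1}$ and $x\mapsto x^{r}B^{(q)}(1/x)/B(x)$ permutes $\mu_{q+1}$. Let $a\in\mathbb{F}_{q^2}\setminus\mathbb{F}_q$ and $b\in\mathbb{F}_q^{*}$. Then $$x^{s}B(x^{q-1})\left(a^{q}x^{2q(q-1)}+bx^{q(q-1)}+a\right)$$ permutes $\mathbb{F}_{q^2}$ if and only if $\gcd(s,q-1)=1$ and $\mathrm{Tr}\left(\frac{a^{q+1}}{b^{2}}\right)\neq 1$.
   Context: $\mu_{q+1}$ denotes the set of $(q+1)$-th roots of unity in $\mathbb{F}_{q^2}$. For $B(x)\in\mathbb{F}_{q^2}[x]$, $B^{(q)}(x)$ denotes the polynomial obtained from $B(x)$ by raising every coefficient to the $q$-th power. $\mathrm{Tr}$ is the absolute trace $\mathbb{F}_q\to\mathbb{F}_2$, $\mathrm{Tr}(x)=x+x^2+x^{2^2}+\cdots+x^{2^{m-1}}$ where $q=2^m$. A polynomial permutes a finite set if it induces a bijection of that set onto itself. -}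

module Defs where

open import Algebra.Bundles using (CommutativeRing; Semiring)
import Algebra.Definitions.RawSemiring as RawSemiringDefinitions
open import Data.Fin.Base using (Fin; toℕ)
open import Data.List.Base using (List; foldr; map)
open import Data.Nat.Base as ℕ using (ℕ)
open import Data.Product.Base using (Σ; Σ-syntax; _,_; proj₁)
open import Function.Bundles using (Inverse)
open import Function.Definitions using (Bijective)
open import Level using (Level; _⊔_; suc)
open import Relation.Binary.Bundles using (Setoid)
import Relation.Binary.Construct.On as On
open import Relation.Binary.Definitions using (_Respects_)
import Relation.Binary.PropositionalEquality as ≡
open import Relation.Unary using (Pred; _∈_)

HasCardinality : ∀ {a ℓ} → Setoid a ℓ → ℕ → Set (a ⊔ ℓ)
HasCardinality S n = Inverse S (≡.setoid (Fin n))

-- A field in the classical (discrete) sense: every x ≉ 0# is invertible.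
-- The value of 0# ⁻¹ is left unspecified.
record Field (c ℓ : Level) : Set (suc (c ⊔ ℓ)) where
  infix 8 _⁻¹
  field
    commutativeRing : CommutativeRing c ℓ
  open CommutativeRing commutativeRing public
  field
    _⁻¹       : Carrier → Carrier
    ⁻¹-cong   : ∀ {x y} → x ≈ y → x ⁻¹ ≈ y ⁻¹
    1≉0       : 1# ≉ 0#
    *-inverse : ∀ {x} → x ≉ 0# → x * x ⁻¹ ≈ 1#

  infixl 7 _/_
  _/_ : Carrier → Carrier → Carrier
  x / y = x * y ⁻¹

  open RawSemiringDefinitions (Semiring.rawSemiring semiring) public using (_^_; sum)

  subsetoid : ∀ {p} → Pred Carrier p → Setoid (c ⊔ p) ℓ
  subsetoid P = On.setoid {B = Σ Carrier P} setoid proj₁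

  record IsSubfield {p} (F : Pred Carrier p) : Set (c ⊔ ℓ ⊔ p) where
    field
      resp      : F Respects _≈_
      0-closed  : 0# ∈ F
      1-closed  : 1# ∈ F
      +-closed  : ∀ {x y} → x ∈ F → y ∈ F → x + y ∈ F
      *-closed  : ∀ {x y} → x ∈ F → y ∈ F → x * y ∈ F
      -‿closed  : ∀ {x} → x ∈ F → - x ∈ F
      ⁻¹-closed : ∀ {x} → x ∈ F → x ≉ 0# → x ⁻¹ ∈ F

  μ : ℕ → Pred Carrier ℓ
  μ n x = x ^ n ≈ 1#

  -- Coefficients in order of increasing degree; trailing zeros are allowed.
  Polynomial : Set c
  Polynomial = List Carrier

  eval : Polynomial → Carrier → Carrier
  eval B x = foldr (λ coeff value → coeff + x * value) 0# B

  -- The polynomial B^(q).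
  conjugate : ℕ → Polynomial → Polynomial
  conjugate q = map (_^ q)

  -- The absolute trace of the subfield of order 2 ^ m, written as an
  -- expression in the ambient field: x + x² + x⁴ + ⋯ + x^(2^(m-1)).
  Tr : ℕ → Carrier → Carrier
  Tr m x = sum {m} (λ i → x ^ (2 ℕ.^ toℕ i))

  Permutes : ∀ {p} → (Carrier → Carrier) → Pred Carrier p → Set (c ⊔ ℓ ⊔ p)
  Permutes f S =
    Σ[ maps ∈ (∀ {x} → x ∈ S → f x ∈ S) ]
      Bijective (Setoid._≈_ (subsetoid S)) (Setoid._≈_ (subsetoid S))
        (λ (x , x∈S) → f x , maps x∈S)

{-# OPTIONS --safe #-}
-- On x ≠ 0 write y = x^(q-1) ∈ μ_{q+1}; the given polynomial is f(x) = x^s B(y) T(y^q)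
-- with T(w) = a^q w² + b w + a.  Since y^q = 1/y, one has T(y^q)^q = y² T(y^q), and
-- s + 2 ≡ r (mod q+1) gives f(x)^q = G(y) f(x) for the permutation
-- G(y) = y^r B^(q)(1/y) / B(y).  So f(x) determines y when T(y^q) ≠ 0, and then x^s,
-- hence x, when gcd(s, q-1) = 1.  A zero of T on μ_{q+1} gives f a nonzero root, and
-- any u with u^s = u^(q-1) = 1 gives f(u) = f(1).  Finally T(y^q) = 0 for some
-- y ∈ μ_{q+1} iff z² + z = a^(q+1)/b² has a solution with z^q + z = 1, where the trace
-- of z² + z telescopes to z^q + z.
module Submission where

open import Defs
import Algebra.Properties.CommutativeMonoid.Sum as Sum
import Algebra.Properties.CommutativeSemiring.Exp as Exp
import Algebra.Properties.Ring as RingProperties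
import Algebra.Solver.Ring.NaturalCoefficients.Default as Solver
open import Data.Fin.Base using (Fin; zero; suc; toℕ)
open import Data.Fin.Permutation using (Permutation′; permutation)
import Data.Fin.Properties as Fin
open import Data.List.Base using ([]; _∷_; length)
open import Data.List.Relation.Unary.All using (All; []; _∷_)
open import Data.Nat.Base as ℕ using (ℕ; zero; suc; _∸_; _%_; _≤_; _<_; z≤n; s≤s)
open import Data.Nat.DivMod using (m≡m%n+[m/n]*n)
open import Data.Nat.Divisibility using (_∣_; divides)
open import Data.Nat.GCD using (gcd; gcd[m,n]∣m; gcd[m,n]∣n; GCD; gcd-GCD; module Bézout)
import Data.Nat.Properties as ℕ
open import Data.Product.Base using (_×_; _,_; proj₁; proj₂; ∃-syntax)
open import Data.Unit.Base using (tt)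
open import Data.Vec.Functional using (removeAt; replicate)
open import Function.Base using (_∘_)
open import Function.Bundles using (_⇔_; mk⇔; module Equivalence; module Inverse)
open import Function.Definitions using (Injective; StrictlySurjective)
open import Relation.Binary.Definitions using (Decidable)
open import Relation.Binary.PropositionalEquality as ≡ using (_≡_; _≢_)
open import Relation.Nullary using (yes; no; ¬_; contradiction)
open import Relation.Nullary.Decidable using (map′)
open import Relation.Unary using (Pred; _∈_; _∉_; U)

-- Injective self-maps of a finite set

Fin-injective⇒surjective : ∀ {n} {f : Fin n → Fin n} →
  Injective _≡_ _≡_ f → StrictlySurjective _≡_ f
Fin-injective⇒surjective {suc n} {f} inj y with Fin.any? (λ i → f i Fin.≟ y)
... | yes hit = hit
... | no miss =
  -- A missed `y` can be punched out of the codomain, leaving an injection of `Fin (suc n)` into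
  -- `Fin n`.
  contradiction (Fin.injective⇒≤ (inj ∘ Fin.punchOut-injective (avoids _) (avoids _))) ℕ.1+n≰n
  where
  avoids : ∀ i → y ≢ f i
  avoids i y≡fi = miss (i , ≡.sym y≡fi)

-- Fields: cancellation, inverses and powers

module FieldProperties {c ℓ} (K : Field c ℓ) where

  open Field K hiding (zero)
  open Exp commutativeSemiring
    using (^-congˡ; ^-congʳ; ^-homo-*; ^-assocʳ; ^-distrib-*)
  open Solver commutativeSemiring using (solve; _:=_; _:+_; _:*_; con)
  open import Relation.Binary.Reasoning.Setoid setoid

  *-cancelˡ-≉0 : ∀ {x y z} → x ≉ 0# → x * y ≈ x * z → y ≈ z
  *-cancelˡ-≉0 {x} {y} {z} x≉0 xy≈xz = trans (sym (undo y)) (trans (*-congˡ xy≈xz) (undo z))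
    where
    undo : ∀ u → x ⁻¹ * (x * u) ≈ u
    undo u = begin
      x ⁻¹ * (x * u) ≈⟨ solve 3 (λ i x u → i :* (x :* u) := (x :* i) :* u) refl (x ⁻¹) x u ⟩
      x * x ⁻¹ * u   ≈⟨ *-congʳ (*-inverse x≉0) ⟩
      1# * u         ≈⟨ *-identityˡ u ⟩
      u              ∎

  *-≉0 : ∀ {x y} → x ≉ 0# → y ≉ 0# → x * y ≉ 0#
  *-≉0 x≉0 y≉0 xy≈0 = y≉0 (*-cancelˡ-≉0 x≉0 (trans xy≈0 (sym (zeroʳ _))))

  *≈1⇒≉0 : ∀ {x y} → x * y ≈ 1# → x ≉ 0#
  *≈1⇒≉0 {x} {y} xy≈1 x≈0 = 1≉0 (trans (sym xy≈1) (trans (*-congʳ x≈0) (zeroˡ y)))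

  ⁻¹-unique : ∀ {x y} → x * y ≈ 1# → y ≈ x ⁻¹
  ⁻¹-unique xy≈1 = *-cancelˡ-≉0 x≉0 (trans xy≈1 (sym (*-inverse x≉0)))
    where x≉0 = *≈1⇒≉0 xy≈1

  ^-≉0 : ∀ {x} n → x ≉ 0# → x ^ n ≉ 0#
  ^-≉0 zero    x≉0 = 1≉0
  ^-≉0 (suc n) x≉0 = *-≉0 x≉0 (^-≉0 n x≉0)

  1^n≈1 : ∀ n → 1# ^ n ≈ 1#
  1^n≈1 zero    = refl
  1^n≈1 (suc n) = trans (*-identityˡ _) (1^n≈1 n)

  0^n≈0 : ∀ {n} → 0 < n → 0# ^ n ≈ 0#
  0^n≈0 {suc n} _ = zeroˡ _

  x^2≈x*x : ∀ x → x ^ 2 ≈ x * x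
  x^2≈x*x x = *-congˡ (*-identityʳ x)

  ≈1⇒^≈1 : ∀ {x} n → x ≈ 1# → x ^ n ≈ 1#
  ≈1⇒^≈1 n x≈1 = trans (^-congˡ n x≈1) (1^n≈1 n)

  ^*≈1 : ∀ x k n → x ^ n ≈ 1# → x ^ (k ℕ.* n) ≈ 1#
  ^*≈1 x k n xⁿ≈1 = trans (^-congʳ x (ℕ.*-comm k n)) (trans (sym (^-assocʳ x n k)) (≈1⇒^≈1 k xⁿ≈1))

  ^-absorb : ∀ x n k j → x ^ j ≈ 1# → x ^ (n ℕ.+ k ℕ.* j) ≈ x ^ n
  ^-absorb x n k j xʲ≈1 =
    trans (^-homo-* x n (k ℕ.* j)) (trans (*-congˡ (^*≈1 x k j xʲ≈1)) (*-identityʳ _))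

  ^-%-cong : ∀ {x} d .{{_ : ℕ.NonZero d}} m n → x ^ d ≈ 1# → m % d ≡ n % d → x ^ m ≈ x ^ n
  ^-%-cong {x} d m n xᵈ≈1 m≡n = trans (reduce m) (trans (^-congʳ x m≡n) (sym (reduce n)))
    where
    reduce : ∀ k → x ^ k ≈ x ^ (k % d)
    reduce k = trans (^-congʳ x (m≡m%n+[m/n]*n k d)) (^-absorb x (k % d) (k ℕ./ d) d xᵈ≈1)

  -- Bézout's identity in the exponent. With natural coefficients it takes two forms, 1 + l n = k m
  -- and 1 + k m = l n, hence the two cases.
  coprime-exponents : ∀ {x} m n → gcd m n ≡ 1 → x ^ m ≈ 1# → x ^ n ≈ 1# → x ≈ 1#
  coprime-exponents {x} m n gcd≡1 xᵐ≈1 xⁿ≈1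
    with Bézout.identity (≡.subst (GCD m n) gcd≡1 (gcd-GCD m n))
  ... | Bézout.Identity.+- k l eq = begin
    x                   ≈⟨ *-identityʳ x ⟨
    x ^ 1               ≈⟨ ^-absorb x 1 l n xⁿ≈1 ⟨
    x ^ (1 ℕ.+ l ℕ.* n) ≈⟨ ^-congʳ x eq ⟩
    x ^ (k ℕ.* m)       ≈⟨ ^*≈1 x k m xᵐ≈1 ⟩
    1#                  ∎
  ... | Bézout.Identity.-+ k l eq = begin
    x                   ≈⟨ *-identityʳ x ⟨
    x ^ 1               ≈⟨ ^-absorb x 1 k m xᵐ≈1 ⟨
    x ^ (1 ℕ.+ k ℕ.* m) ≈⟨ ^-congʳ x eq ⟩
    x ^ (l ℕ.* n)       ≈⟨ ^*≈1 x l n xⁿ≈1 ⟩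
    1#                  ∎

  -- The ratio x / y has trivial m-th and n-th powers, so `coprime-exponents` makes it 1.
  coprime-powers-injective : ∀ {x y} m n → gcd m n ≡ 1 → y ≉ 0# →
    x ^ m ≈ y ^ m → x ^ n ≈ y ^ n → x ≈ y
  coprime-powers-injective {x} {y} m n gcd≡1 y≉0 xᵐ≈yᵐ xⁿ≈yⁿ = begin
    x                ≈⟨ *-identityʳ x ⟨
    x * 1#           ≈⟨ *-congˡ (*-inverse y≉0) ⟨
    x * (y * y ⁻¹)   ≈⟨ solve 3 (λ x y i → x :* (y :* i) := (x :* i) :* y) refl x y (y ⁻¹) ⟩
    x * y ⁻¹ * y     ≈⟨ *-congʳ (coprime-exponents m n gcd≡1 (ratio m xᵐ≈yᵐ) (ratio n xⁿ≈yⁿ)) ⟩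
    1# * y           ≈⟨ *-identityˡ y ⟩
    y                ∎
    where
    ratio : ∀ k → x ^ k ≈ y ^ k → (x * y ⁻¹) ^ k ≈ 1#
    ratio k eq = begin
      (x * y ⁻¹) ^ k     ≈⟨ ^-distrib-* x (y ⁻¹) k ⟩
      x ^ k * (y ⁻¹) ^ k ≈⟨ *-congʳ eq ⟩
      y ^ k * (y ⁻¹) ^ k ≈⟨ ^-distrib-* y (y ⁻¹) k ⟨
      (y * y ⁻¹) ^ k     ≈⟨ ≈1⇒^≈1 k (*-inverse y≉0) ⟩
      1#                 ∎

  -- Polynomial evaluation and synthetic division

  eval-cong : ∀ B {x y} → x ≈ y → eval B x ≈ eval B y
  eval-cong []      x≈y = refl
  eval-cong (c ∷ B) x≈y = +-congˡ (*-cong x≈y (eval-cong B x≈y))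

  -- Horner's intermediate values at `r`. They are the coefficients of the quotient of `c ∷ p` by x
  -- - r, whatever the constant term `c`.
  suffixValues : Polynomial → Carrier → Polynomial
  suffixValues []      r = []
  suffixValues (c ∷ p) r = eval (c ∷ p) r ∷ suffixValues p r

  -- p(x) - p(r) = (x - r) Q(x), with Q given by synthetic division and the
  -- terms moved so that no subtraction occurs.
  eval-quotient : ∀ c p x r →
    eval (c ∷ p) x + r * eval (suffixValues p r) x ≈ eval (c ∷ p) r + x * eval (suffixValues p r) x
  eval-quotient c []      x r = solve 3 (λ c x r →
    c :+ x :* con 0 :+ r :* con 0 := c :+ r :* con 0 :+ x :* con 0) refl c x r
  eval-quotient c (d ∷ p) x r = begin
    c + x * px + r * (pr + x * qx) ≈⟨ solve 6 (λ c x r px pr qx →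
      c :+ x :* px :+ r :* (pr :+ x :* qx) := c :+ x :* (px :+ r :* qx) :+ r :* pr) refl c x r px pr qx ⟩
    c + x * (px + r * qx) + r * pr ≈⟨ +-congʳ (+-congˡ (*-congˡ (eval-quotient d p x r))) ⟩
    c + x * (pr + x * qx) + r * pr ≈⟨ solve 5 (λ c x r pr qx →
      c :+ x :* (pr :+ x :* qx) :+ r :* pr := c :+ r :* pr :+ x :* (pr :+ x :* qx)) refl c x r pr qx ⟩
    c + r * pr + x * (pr + x * qx) ∎
    where
    px = eval (d ∷ p) x
    pr = eval (d ∷ p) r
    qx = eval (suffixValues p r) x

  length-suffixValues : ∀ p r → length (suffixValues p r) ≡ length p
  length-suffixValues []      r = ≡.refl
  length-suffixValues (c ∷ p) r = ≡.cong suc (length-suffixValues p r)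

  -- A coefficient is its suffix value minus `r` times the next one. This brings the vanishing of a
  -- quotient back to the polynomial that was divided.
  suffixValues-zero : ∀ p r → All (_≈ 0#) (suffixValues p r) → All (_≈ 0#) p
  suffixValues-zero []      r []           = []
  suffixValues-zero (c ∷ p) r (v≈0 ∷ vs≈0) = c≈0 ∷ suffixValues-zero p r vs≈0
    where
    head≈0 : ∀ p → All (_≈ 0#) (suffixValues p r) → eval p r ≈ 0#
    head≈0 []      _         = refl
    head≈0 (d ∷ p) (eq ∷ _)  = eq
    c≈0 : c ≈ 0#
    c≈0 = begin
      c                ≈⟨ solve 2 (λ c r → c := c :+ r :* con 0) refl c r ⟩
      c + r * 0#       ≈⟨ +-congˡ (*-congˡ (head≈0 p vs≈0)) ⟨
      c + r * eval p r ≈⟨ v≈0 ⟩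
      0#               ∎

  monomial : ℕ → Polynomial
  monomial zero    = 1# ∷ []
  monomial (suc n) = 0# ∷ monomial n

  length-monomial : ∀ n → length (monomial n) ≡ suc n
  length-monomial zero    = ≡.refl
  length-monomial (suc n) = ≡.cong suc (length-monomial n)

  eval-monomial : ∀ n x → eval (monomial n) x ≈ x ^ n
  eval-monomial zero    x = solve 1 (λ x → con 1 :+ x :* con 0 := con 1) refl x
  eval-monomial (suc n) x = trans (+-identityˡ _) (*-congˡ (eval-monomial n x))

  monomial-nonzero : ∀ n → ¬ All (_≈ 0#) (monomial n)
  monomial-nonzero zero    (1≈0 ∷ _) = 1≉0 1≈0
  monomial-nonzero (suc n) (_ ∷ eqs) = monomial-nonzero n eqs

  -- Counting roots

  module DecidableEquality (_≟_ : Decidable _≈_) where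

    -- Induction by dividing out `root zero`: the quotient is one coefficient shorter and still
    -- vanishes at the other roots. Since trailing zeros are allowed, list length stands for degree
    -- plus one, and being the zero polynomial means that all coefficients vanish.
    root-bound : ∀ {n} (p : Polynomial) (root : Fin n → Carrier) → Injective _≡_ _≈_ root →
      length p ≤ n → (∀ i → eval p (root i) ≈ 0#) → All (_≈ 0#) p
    root-bound []      root inj _         _  = []
    root-bound (c ∷ p) root inj (s≤s len) eq =
      suffixValues-zero (c ∷ p) r (eq zero ∷
        root-bound (suffixValues p r) (root ∘ suc) (Fin.suc-injective ∘ inj)
          (ℕ.≤-trans (ℕ.≤-reflexive (length-suffixValues p r)) len) quotient≈0)
      where
      r = root zero
      quotient≈0 : ∀ i → eval (suffixValues p r) (root (suc i)) ≈ 0#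
      quotient≈0 i with eval (suffixValues p r) (root (suc i)) ≟ 0#
      ... | yes v≈0 = v≈0
      -- A nonzero quotient value `v` could be cancelled from `v * r ≈ v * x`, identifying two
      -- distinct roots.
      ... | no  v≉0 = contradiction (inj (*-cancelˡ-≉0 v≉0 vr≈vx)) λ ()
        where
        x = root (suc i)
        v = eval (suffixValues p r) x
        vr≈vx : v * r ≈ v * x
        vr≈vx = begin
          v * r                     ≈⟨ solve 2 (λ v r → v :* r := con 0 :+ r :* v) refl v r ⟩
          0# + r * v                ≈⟨ +-congʳ (eq (suc i)) ⟨
          eval (c ∷ p) x + r * v    ≈⟨ eval-quotient c p x r ⟩
          eval (c ∷ p) r + x * v    ≈⟨ +-congʳ (eq zero) ⟩
          0# + x * v                ≈⟨ solve 2 (λ v x → con 0 :+ x :* v := v :* x) refl v x ⟩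
          v * x                     ∎

    -- The polynomial x^k - x has k + 1 coefficients, so more than k distinct zeros would force its
    -- leading coefficient 1 to vanish.
    few-fixed-points : ∀ {n k} (x : Fin n → Carrier) → Injective _≡_ _≈_ x →
      1 < k → k < n → ¬ (∀ i → x i ^ k ≈ x i)
    few-fixed-points {k = suc (suc n)} x inj (s≤s (s≤s _)) k<n fixed with
      -- As k ≥ 2, the coefficients of x^k - x are 0 and -1 followed by those of x^(k-2); here `n`
      -- is k - 2.
      root-bound (0# ∷ - 1# ∷ monomial n) x inj
        (ℕ.≤-trans (ℕ.≤-reflexive (≡.cong (2 ℕ.+_) (length-monomial n))) k<n) vanishes
      where
      vanishes : ∀ i → eval (0# ∷ - 1# ∷ monomial n) (x i) ≈ 0#
      vanishes i = begin
        0# + u * (- 1# + u * eval (monomial n) u) ≈⟨ +-congˡ (*-congˡ (+-congˡ (*-congˡ (eval-monomial n u)))) ⟩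
        0# + u * (- 1# + u * u ^ n)   ≈⟨ solve 3 (λ u o w → con 0 :+ u :* (o :+ u :* w) := u :* o :+ u :* (u :* w)) refl u (- 1#) (u ^ n) ⟩
        u * - 1# + u ^ (2 ℕ.+ n)      ≈⟨ +-congˡ (trans (fixed i) (sym (*-identityʳ u))) ⟩
        u * - 1# + u * 1#             ≈⟨ distribˡ u (- 1#) 1# ⟨
        u * (- 1# + 1#)               ≈⟨ *-congˡ (-‿inverseˡ 1#) ⟩
        u * 0#                        ≈⟨ zeroʳ u ⟩
        0#                            ∎
        where u = x i
    ... | _ ∷ _ ∷ monomial≈0 = monomial-nonzero n monomial≈0

    -- Fermat's little theorem in a finite subfield

    module FiniteSubfield {p n} {F : Pred Carrier p} (isSubfield : IsSubfield F)
      (finite : HasCardinality (subsetoid F) n) where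

      open IsSubfield isSubfield
      open Inverse finite using (to; from; to-cong; strictlyInverseˡ; strictlyInverseʳ)
      -- Sums in the multiplicative monoid: `Π.sum` is a product, and the sum of a constant family
      -- is a power.
      module Π = Sum *-commutativeMonoid

      element : Fin n → Carrier
      element i = proj₁ (from i)

      element∈F : ∀ i → element i ∈ F
      element∈F i = proj₂ (from i)

      element-injective : Injective _≡_ _≈_ element
      element-injective {i} {j} eq = ≡.trans (≡.sym (strictlyInverseˡ i))
        (≡.trans (to-cong {x = from i} {y = from j} eq) (strictlyInverseˡ j))

      scale : ∀ {x} → x ∈ F → Fin n → Fin n
      scale {x} x∈F i = to (x * element i , *-closed x∈F (element∈F i))

      element-scale : ∀ {x} (x∈F : x ∈ F) i → element (scale x∈F i) ≈ x * element i
      element-scale x∈F i = strictlyInverseʳ _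

      scale-inverse : ∀ {x y} (x∈F : x ∈ F) (y∈F : y ∈ F) → x * y ≈ 1# →
        ∀ i → scale x∈F (scale y∈F i) ≡ i
      scale-inverse {x} {y} x∈F y∈F xy≈1 i = element-injective (begin
        element (scale x∈F (scale y∈F i)) ≈⟨ element-scale x∈F _ ⟩
        x * element (scale y∈F i)         ≈⟨ *-congˡ (element-scale y∈F i) ⟩
        x * (y * element i)               ≈⟨ *-assoc x y _ ⟨
        x * y * element i                 ≈⟨ *-congʳ xy≈1 ⟩
        1# * element i                    ≈⟨ *-identityˡ _ ⟩
        element i                         ∎)

      scalePermutation : ∀ {x} → x ∈ F → x ≉ 0# → Permutation′ n
      scalePermutation x∈F x≉0 = permutation (scale x∈F) (scale x⁻¹∈F)
        (scale-inverse x∈F x⁻¹∈F (*-inverse x≉0))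
        (scale-inverse x⁻¹∈F x∈F (trans (*-comm _ _) (*-inverse x≉0)))
        where x⁻¹∈F = ⁻¹-closed x∈F x≉0

      -- Replaces the factor `u` by 1 where `z` is zero, so that products over all of `F`
      -- effectively run over its nonzero elements and need no second enumeration.
      unless0 : Carrier → Carrier → Carrier
      unless0 z u with z ≟ 0#
      ... | yes _ = 1#
      ... | no  _ = u

      unless0-≈0 : ∀ {z} u → z ≈ 0# → unless0 z u ≈ 1#
      unless0-≈0 {z} u z≈0 with z ≟ 0#
      ... | yes _  = refl
      ... | no z≉0 = contradiction z≈0 z≉0

      unless0-≉0 : ∀ {z} u → z ≉ 0# → unless0 z u ≈ u
      unless0-≉0 {z} u z≉0 with z ≟ 0#
      ... | yes z≈0 = contradiction z≈0 z≉0
      ... | no _    = refl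

      unless0-self≉0 : ∀ z → unless0 z z ≉ 0#
      unless0-self≉0 z with z ≟ 0#
      ... | yes _  = 1≉0
      ... | no z≉0 = z≉0

      product≉0 : ∀ {k} (t : Fin k → Carrier) → (∀ i → t i ≉ 0#) → Π.sum t ≉ 0#
      product≉0 {zero}  t t≉0 = 1≉0
      product≉0 {suc k} t t≉0 = *-≉0 (t≉0 zero) (product≉0 (t ∘ suc) (t≉0 ∘ suc))

      -- Scaling by `x` permutes the nonzero elements, so their product is unchanged when each of
      -- them acquires a factor `x`; that product is nonzero and cancels.
      product-unless0 : ∀ {x} → x ∈ F → x ≉ 0# → Π.sum (λ i → unless0 (element i) x) ≈ 1#
      product-unless0 {x} x∈F x≉0 = *-cancelˡ-≉0 (product≉0 _ (unless0-self≉0 ∘ element)) (begin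
        Π.sum nonzero * Π.sum (λ i → unless0 (element i) x)   ≈⟨ *-comm _ _ ⟩
        Π.sum (λ i → unless0 (element i) x) * Π.sum nonzero   ≈⟨ Π.∑-distrib-+ _ nonzero ⟨
        Π.sum (λ i → unless0 (element i) x * nonzero i)       ≈⟨ Π.sum-cong-≋ scaled ⟨
        Π.sum (nonzero ∘ scale x∈F)                           ≈⟨ Π.sum-permute nonzero (scalePermutation x∈F x≉0) ⟨
        Π.sum nonzero                                         ≈⟨ *-identityʳ _ ⟨
        Π.sum nonzero * 1#                                    ∎)
        where
        nonzero : Fin n → Carrier
        nonzero i = unless0 (element i) (element i)
        scaled : ∀ i → nonzero (scale x∈F i) ≈ unless0 (element i) x * nonzero i
        scaled i with element i ≟ 0#
        ... | yes e≈0 = trans (unless0-≈0 _ (trans (element-scale x∈F i) (trans (*-congˡ e≈0) (zeroʳ x))))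
                              (sym (*-identityˡ 1#))
        ... | no e≉0 = trans (unless0-≉0 _ λ eq → *-≉0 x≉0 e≉0 (trans (sym (element-scale x∈F i)) eq))
                             (element-scale x∈F i)

      -- By injectivity `i` is the only index holding zero; its factor is 1 and the other k - 1
      -- factors are `x`.
      product-unless0-at-zero : ∀ {k} (t : Fin k → Carrier) → Injective _≡_ _≈_ t →
        ∀ i x → t i ≈ 0# → Π.sum (λ j → unless0 (t j) x) ≈ x ^ (k ∸ 1)
      product-unless0-at-zero {suc k} t inj i x tᵢ≈0 = begin
        Π.sum v                       ≈⟨ Π.sum-remove {i = i} v ⟩
        v i * Π.sum (removeAt v i)    ≈⟨ *-cong (unless0-≈0 x tᵢ≈0) (Π.sum-cong-≋ rest) ⟩
        1# * Π.sum (replicate k x)    ≈⟨ *-identityˡ _ ⟩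
        Π.sum (replicate k x)         ≈⟨ Π.sum-replicate k ⟩
        x ^ k                         ∎
        where
        v : Fin (suc k) → Carrier
        v j = unless0 (t j) x
        rest : ∀ j → removeAt v i j ≈ x
        rest j = unless0-≉0 x λ t≈0 → Fin.punchInᵢ≢i i j (inj (trans t≈0 (sym tᵢ≈0)))

      -- Two evaluations of the product of one factor `x` for each nonzero element of `F`.
      x^[n∸1]≈1 : ∀ {x} → x ∈ F → x ≉ 0# → x ^ (n ∸ 1) ≈ 1#
      x^[n∸1]≈1 {x} x∈F x≉0 = trans
        (sym (product-unless0-at-zero element element-injective (to (0# , 0-closed)) x (strictlyInverseʳ _)))
        (product-unless0 x∈F x≉0)

      x^n≈x : ∀ {x} → 0 < n → x ∈ F → x ^ n ≈ x
      x^n≈x {x} 0<n x∈F with x ≟ 0#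
      ... | yes x≈0 = trans (^-congˡ n x≈0) (trans (0^n≈0 0<n) (sym x≈0))
      ... | no  x≉0 = begin
        x ^ n             ≈⟨ ^-congʳ x (ℕ.m+[n∸m]≡n 0<n) ⟨
        x * x ^ (n ∸ 1)   ≈⟨ *-congˡ (x^[n∸1]≈1 x∈F x≉0) ⟩
        x * 1#            ≈⟨ *-identityʳ x ⟩
        x                 ∎

      -- If `x` lay outside `F`, then `x` and the n elements of `F` would be n + 1 distinct
      -- solutions of x^n = x.
      fixed⇒¬∉ : ∀ {x} → 1 < n → x ^ n ≈ x → ¬ x ∉ F
      fixed⇒¬∉ {x} 1<n xⁿ≈x x∉F =
        few-fixed-points roots roots-injective 1<n (ℕ.n<1+n n) fixed
        where
        roots : Fin (suc n) → Carrier
        roots zero    = x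
        roots (suc i) = element i
        roots-injective : Injective _≡_ _≈_ roots
        roots-injective {zero}  {zero}  eq = ≡.refl
        roots-injective {zero}  {suc j} eq = contradiction (resp (sym eq) (element∈F j)) x∉F
        roots-injective {suc i} {zero}  eq = contradiction (resp eq (element∈F i)) x∉F
        roots-injective {suc i} {suc j} eq = ≡.cong suc (element-injective eq)
        fixed : ∀ i → roots i ^ n ≈ roots i
        fixed zero    = xⁿ≈x
        fixed (suc i) = x^n≈x (ℕ.<-trans (s≤s z≤n) 1<n) (element∈F i)

  -- Characteristic 2: Frobenius, trace and Artin-Schreier equations

  module Characteristic2 (1+1≈0 : 1# + 1# ≈ 0#) where

    module Σ+ = Sum +-commutativeMonoid

    x+x≈0 : ∀ x → x + x ≈ 0#
    x+x≈0 x = begin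
      x + x          ≈⟨ solve 1 (λ x → x :+ x := x :* (con 1 :+ con 1)) refl x ⟩
      x * (1# + 1#)  ≈⟨ *-congˡ 1+1≈0 ⟩
      x * 0#         ≈⟨ zeroʳ x ⟩
      0#             ∎

    x+[y+y]≈x : ∀ x y → x + (y + y) ≈ x
    x+[y+y]≈x x y = trans (+-congˡ (x+x≈0 y)) (+-identityʳ x)

    x+y≈0⇒x≈y : ∀ {x y} → x + y ≈ 0# → x ≈ y
    x+y≈0⇒x≈y {x} {y} x+y≈0 = begin
      x             ≈⟨ x+[y+y]≈x x y ⟨
      x + (y + y)   ≈⟨ +-assoc x y y ⟨
      x + y + y     ≈⟨ +-congʳ x+y≈0 ⟩
      0# + y        ≈⟨ +-identityˡ y ⟩
      y             ∎

    square-+ : ∀ x y → (x + y) ^ 2 ≈ x ^ 2 + y ^ 2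
    square-+ x y = begin
      (x + y) ^ 2                       ≈⟨ x^2≈x*x (x + y) ⟩
      (x + y) * (x + y)                 ≈⟨ solve 2 (λ x y → (x :+ y) :* (x :+ y) := x :* x :+ y :* y :+ (x :* y :+ x :* y)) refl x y ⟩
      x * x + y * y + (x * y + x * y)   ≈⟨ x+[y+y]≈x _ (x * y) ⟩
      x * x + y * y                     ≈⟨ +-cong (x^2≈x*x x) (x^2≈x*x y) ⟨
      x ^ 2 + y ^ 2                     ∎

    ^2^suc : ∀ x m → x ^ (2 ℕ.^ suc m) ≈ (x ^ 2) ^ (2 ℕ.^ m)
    ^2^suc x m = sym (^-assocʳ x 2 (2 ℕ.^ m))

    frobenius-+ : ∀ m x y → (x + y) ^ (2 ℕ.^ m) ≈ x ^ (2 ℕ.^ m) + y ^ (2 ℕ.^ m)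
    frobenius-+ zero    x y = solve 2 (λ x y → (x :+ y) :* con 1 := x :* con 1 :+ y :* con 1) refl x y
    frobenius-+ (suc m) x y = begin
      (x + y) ^ (2 ℕ.^ suc m)                         ≈⟨ ^2^suc (x + y) m ⟩
      ((x + y) ^ 2) ^ (2 ℕ.^ m)                       ≈⟨ ^-congˡ (2 ℕ.^ m) (square-+ x y) ⟩
      (x ^ 2 + y ^ 2) ^ (2 ℕ.^ m)                     ≈⟨ frobenius-+ m (x ^ 2) (y ^ 2) ⟩
      (x ^ 2) ^ (2 ℕ.^ m) + (y ^ 2) ^ (2 ℕ.^ m)       ≈⟨ +-cong (^2^suc x m) (^2^suc y m) ⟨
      x ^ (2 ℕ.^ suc m) + y ^ (2 ℕ.^ suc m)           ∎

    Tr-cong : ∀ m {x y} → x ≈ y → Tr m x ≈ Tr m y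
    Tr-cong m x≈y = Σ+.sum-cong-≋ {m} λ i → ^-congˡ (2 ℕ.^ toℕ i) x≈y

    Tr-+ : ∀ m x y → Tr m (x + y) ≈ Tr m x + Tr m y
    Tr-+ m x y = trans (Σ+.sum-cong-≋ {m} λ i → frobenius-+ (toℕ i) x y)
      (Σ+.∑-distrib-+ {m} (λ i → x ^ (2 ℕ.^ toℕ i)) (λ i → y ^ (2 ℕ.^ toℕ i)))

    -- Here `m` is any number of summands: the inductions below run over partial sums of the trace.
    Tr-head : ∀ m x → Tr (suc m) x ≈ x + Tr m (x ^ 2)
    Tr-head m x = +-cong (*-identityʳ x) (Σ+.sum-cong-≋ {m} λ i → ^2^suc x (toℕ i))

    Tr-last : ∀ m x → Tr (suc m) x ≈ Tr m x + x ^ (2 ℕ.^ m)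
    Tr-last m x = trans (Σ+.sum-init-last {m} (λ i → x ^ (2 ℕ.^ toℕ i)))
      (+-cong (Σ+.sum-cong-≋ {m} λ i → ^-congʳ x (≡.cong (2 ℕ.^_) (Fin.toℕ-inject₁ i)))
              (^-congʳ x (≡.cong (2 ℕ.^_) (Fin.toℕ-fromℕ m))))

    Tr-square : ∀ m x → Tr m x ^ 2 ≈ Tr m (x ^ 2)
    Tr-square zero    x = zeroˡ _
    Tr-square (suc m) x = begin
      Tr (suc m) x ^ 2              ≈⟨ ^-congˡ 2 (Tr-head m x) ⟩
      (x + Tr m (x ^ 2)) ^ 2        ≈⟨ square-+ x _ ⟩
      x ^ 2 + Tr m (x ^ 2) ^ 2      ≈⟨ +-congˡ (Tr-square m (x ^ 2)) ⟩
      x ^ 2 + Tr m ((x ^ 2) ^ 2)    ≈⟨ Tr-head m (x ^ 2) ⟨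
      Tr (suc m) (x ^ 2)            ∎

    -- The summands are z^(2^(i+1)) + z^(2^i), and in characteristic 2 only the two ends survive.
    -- The induction passes from z to z².
    Tr-telescopes : ∀ m z → Tr m (z * z + z) ≈ z ^ (2 ℕ.^ m) + z
    Tr-telescopes zero    z = sym (trans (+-congʳ (*-identityʳ z)) (x+x≈0 z))
    Tr-telescopes (suc m) z = begin
      Tr (suc m) (z * z + z)                        ≈⟨ Tr-head m _ ⟩
      z * z + z + Tr m ((z * z + z) ^ 2)            ≈⟨ +-congˡ (Tr-cong m (square-+ (z * z) z)) ⟩
      z * z + z + Tr m ((z * z) ^ 2 + z ^ 2)        ≈⟨ +-congˡ (Tr-cong m (+-cong (x^2≈x*x _) (x^2≈x*x z))) ⟩
      z * z + z + Tr m (z * z * (z * z) + z * z)    ≈⟨ +-congˡ (Tr-telescopes m (z * z)) ⟩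
      z * z + z + ((z * z) ^ (2 ℕ.^ m) + z * z)     ≈⟨ +-congˡ (+-congʳ (trans (^-congˡ (2 ℕ.^ m) (sym (x^2≈x*x z))) (sym (^2^suc z m)))) ⟩
      z * z + z + (z ^ (2 ℕ.^ suc m) + z * z)       ≈⟨ solve 3 (λ s z t → s :+ z :+ (t :+ s) := t :+ z :+ (s :+ s)) refl (z * z) z _ ⟩
      z ^ (2 ℕ.^ suc m) + z + (z * z + z * z)       ≈⟨ x+[y+y]≈x _ (z * z) ⟩
      z ^ (2 ℕ.^ suc m) + z                         ∎

    -- The witness is w = Σ_{i<m} Tr_i(e) d^(2^i), as in the additive Hilbert 90.
    artin-schreier : ∀ m d e → ∃[ w ] w * w + w ≈ Tr m e * d ^ (2 ℕ.^ m) + e * (Tr m d * Tr m d)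
    artin-schreier zero    d e = 0# , solve 2 (λ e d →
      con 0 :* con 0 :+ con 0 := con 0 :* d :+ e :* (con 0 :* con 0)) refl e (d ^ 1)
    artin-schreier (suc m) d e with w , w²+w ← artin-schreier m d e = w + S * D , (begin
      (w + S * D) * (w + S * D) + (w + S * D)
        ≈⟨ solve 3 (λ w S D → (w :+ S :* D) :* (w :+ S :* D) :+ (w :+ S :* D)
             := w :* w :+ w :+ (S :* S :* (D :* D) :+ S :* D) :+ (w :* (S :* D) :+ w :* (S :* D))) refl w S D ⟩
      w * w + w + (S * S * (D * D) + S * D) + (w * (S * D) + w * (S * D))
        ≈⟨ x+[y+y]≈x _ _ ⟩
      w * w + w + (S * S * (D * D) + S * D)
        ≈⟨ +-congʳ w²+w ⟩
      S * D + e * (T * T) + (S * S * (D * D) + S * D)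
        ≈⟨ solve 4 (λ S D T e → S :* D :+ e :* (T :* T) :+ (S :* S :* (D :* D) :+ S :* D)
             := e :* (T :* T) :+ S :* S :* (D :* D) :+ (S :* D :+ S :* D)) refl S D T e ⟩
      e * (T * T) + S * S * (D * D) + (S * D + S * D)
        ≈⟨ x+[y+y]≈x _ _ ⟩
      e * (T * T) + S * S * (D * D)
        -- Adding e D² + e T D twice adds zero and completes the products (e + S²) D² and e (T +
        -- D)².
        ≈⟨ x+[y+y]≈x _ _ ⟨
      e * (T * T) + S * S * (D * D) + ((e * (D * D) + e * (T * D)) + (e * (D * D) + e * (T * D)))
        ≈⟨ solve 4 (λ S D T e → e :* (T :* T) :+ S :* S :* (D :* D) :+ ((e :* (D :* D) :+ e :* (T :* D)) :+ (e :* (D :* D) :+ e :* (T :* D)))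
             := (e :+ S :* S) :* (D :* D) :+ e :* ((T :+ D) :* (T :+ D))) refl S D T e ⟩
      (e + S * S) * (D * D) + e * ((T + D) * (T + D))
        ≈⟨ +-cong (*-cong S′ D′) (*-congˡ (*-cong (Tr-last m d) (Tr-last m d))) ⟨
      Tr (suc m) e * d ^ (2 ℕ.^ suc m) + e * (Tr (suc m) d * Tr (suc m) d) ∎)
      where
      S = Tr m e
      T = Tr m d
      D = d ^ (2 ℕ.^ m)
      S′ : Tr (suc m) e ≈ e + S * S
      S′ = trans (Tr-head m e) (+-congˡ (trans (sym (Tr-square m e)) (x^2≈x*x S)))
      D′ : d ^ (2 ℕ.^ suc m) ≈ D * D
      D′ = trans (^-congʳ d (ℕ.*-comm 2 (2 ℕ.^ m))) (trans (sym (^-assocʳ d (2 ℕ.^ m) 2)) (x^2≈x*x D))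

-- Finite fields: decidable equality and self-maps

module FiniteField {c ℓ} (K : Field c ℓ) {n} (finite : HasCardinality (Field.setoid K) n) where

  open Field K
  open Inverse finite

  infix 4 _≟_
  _≟_ : Decidable _≈_
  x ≟ y = map′ (λ eq → trans (sym (strictlyInverseʳ x)) (trans (from-cong eq) (strictlyInverseʳ y)))
               to-cong (to x Fin.≟ to y)

  -- The whole field as a subfield of itself, so that Fermat's theorem for subfields also covers
  -- `K`.
  U-isSubfield : IsSubfield U
  U-isSubfield = _

  U-finite : HasCardinality (subsetoid U) n
  U-finite = record
    { to        = to ∘ proj₁
    ; from      = λ i → from i , tt
    ; to-cong   = to-cong
    ; from-cong = from-cong
    ; inverse   = inverseˡ , inverseʳ
    }

  injective⇒surjective : ∀ {f : Carrier → Carrier} → Injective _≈_ _≈_ f → StrictlySurjective _≈_ f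
  injective⇒surjective {f} inj y with Fin-injective⇒surjective code-injective (to y)
    where
    code-injective : Injective _≡_ _≡_ (to ∘ f ∘ from)
    code-injective {i} {j} eq = ≡.trans (≡.sym (strictlyInverseˡ i)) (≡.trans (to-cong (inj
      (trans (sym (strictlyInverseʳ _)) (trans (from-cong eq) (strictlyInverseʳ _))))) (strictlyInverseˡ j))
  ... | i , eq = from i , trans (sym (strictlyInverseʳ _)) (trans (from-cong eq) (strictlyInverseʳ y))

-- The quadratic extension: conjugation, norm-one elements and torsion

module QuadraticExtension {c ℓ p} (m q : ℕ) (1≤m : 1 ≤ m) (q≡2^m : q ≡ 2 ℕ.^ m)
  (K : Field c ℓ) (K-finite : HasCardinality (Field.setoid K) (q ℕ.^ 2))
  (F : Pred (Field.Carrier K) p) (F-isSubfield : Field.IsSubfield K F)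
  (F-finite : HasCardinality (Field.subsetoid K F) q) where

  open Field K hiding (zero)
  open Exp commutativeSemiring
    using (^-congˡ; ^-congʳ; ^-homo-*; ^-assocʳ; ^-distrib-*)
  open Solver commutativeSemiring using (solve; _:=_; _:+_; _:*_; con)
  open RingProperties ring using (-‿distribˡ-*; -‿involutive)
  open import Relation.Binary.Reasoning.Setoid setoid
  open FieldProperties K
  open FiniteField K K-finite
  open DecidableEquality _≟_
  open IsSubfield F-isSubfield
  private
    module Fq = FiniteSubfield F-isSubfield F-finite
    module Kq² = FiniteSubfield U-isSubfield U-finite

  1<q : 1 < q
  1<q = ≡.subst (1 <_) (≡.sym q≡2^m) (ℕ.^-monoʳ-≤ 2 1≤m)

  0<q : 0 < q
  0<q = ℕ.<-trans (s≤s z≤n) 1<q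

  ^q≈ : ∀ x → x ^ q ≈ x ^ (2 ℕ.^ m)
  ^q≈ x = ^-congʳ x q≡2^m

  F-conj : ∀ {x} → x ∈ F → x ^ q ≈ x
  F-conj = Fq.x^n≈x 0<q

  ∉F-conj : ∀ {x} → x ∉ F → x ^ q ≉ x
  ∉F-conj x∉F xᑫ≈x = Fq.fixed⇒¬∉ 1<q xᑫ≈x x∉F

  -- The field `K` has q² elements, so x^(q²) = x.
  conj-involutive : ∀ x → (x ^ q) ^ q ≈ x
  conj-involutive x = begin
    (x ^ q) ^ q    ≈⟨ ^-assocʳ x q q ⟩
    x ^ (q ℕ.* q)  ≈⟨ ^-congʳ x (≡.cong (q ℕ.*_) (ℕ.*-identityʳ q)) ⟨
    x ^ (q ℕ.^ 2)  ≈⟨ Kq².x^n≈x (ℕ.m^n>0 q {{ℕ.>-nonZero 0<q}} 2) tt ⟩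
    x              ∎

  -- q is even, so -1 = (-1)^q = 1.
  1+1≈0 : 1# + 1# ≈ 0#
  1+1≈0 = trans (+-congʳ 1≈-1) (-‿inverseˡ 1#)
    where
    [-1]^2≈1 : (- 1#) ^ 2 ≈ 1#
    [-1]^2≈1 = begin
      (- 1#) ^ 2      ≈⟨ x^2≈x*x (- 1#) ⟩
      - 1# * - 1#     ≈⟨ -‿distribˡ-* 1# (- 1#) ⟨
      - (1# * - 1#)   ≈⟨ -‿cong (*-identityˡ _) ⟩
      - - 1#          ≈⟨ -‿involutive 1# ⟩
      1#              ∎
    q-even : q ≡ 2 ℕ.^ (m ∸ 1) ℕ.* 2
    q-even = ≡.trans q≡2^m (≡.trans (≡.cong (2 ℕ.^_) (≡.sym (ℕ.m+[n∸m]≡n 1≤m))) (ℕ.*-comm 2 (2 ℕ.^ (m ∸ 1))))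
    1≈-1 : 1# ≈ - 1#
    1≈-1 = begin
      1#             ≈⟨ ^*≈1 (- 1#) (2 ℕ.^ (m ∸ 1)) 2 [-1]^2≈1 ⟨
      (- 1#) ^ (2 ℕ.^ (m ∸ 1) ℕ.* 2) ≈⟨ ^-congʳ (- 1#) q-even ⟨
      (- 1#) ^ q     ≈⟨ F-conj (-‿closed 1-closed) ⟩
      - 1#           ∎

  open Characteristic2 1+1≈0

  conj-+ : ∀ x y → (x + y) ^ q ≈ x ^ q + y ^ q
  conj-+ x y = trans (^q≈ _) (trans (frobenius-+ m x y) (sym (+-cong (^q≈ x) (^q≈ y))))

  conj-* : ∀ x y → (x * y) ^ q ≈ x ^ q * y ^ q
  conj-* x y = ^-distrib-* x y q

  conj-⁻¹ : ∀ {x} → x ≉ 0# → (x ⁻¹) ^ q ≈ (x ^ q) ⁻¹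
  conj-⁻¹ {x} x≉0 = ⁻¹-unique (trans (sym (conj-* x (x ⁻¹))) (≈1⇒^≈1 q (*-inverse x≉0)))

  Tr-artin-schreier : ∀ z → Tr m (z * z + z) ≈ z ^ q + z
  Tr-artin-schreier z = trans (Tr-telescopes m z) (+-congʳ (sym (^q≈ z)))

  conj-eval : ∀ B {x y} → x ^ q ≈ y → eval B x ^ q ≈ eval (conjugate q B) y
  conj-eval []      xᑫ≈y = 0^n≈0 0<q
  conj-eval (c ∷ B) xᑫ≈y = trans (conj-+ _ _) (+-congˡ (trans (conj-* _ _) (*-cong xᑫ≈y (conj-eval B xᑫ≈y))))

  x*x^[q∸1]≈x^q : ∀ x → x * x ^ (q ∸ 1) ≈ x ^ q
  x*x^[q∸1]≈x^q x = ^-congʳ x (ℕ.m+[n∸m]≡n 0<q)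

  -- The norm form unfolds from `y ^ suc q` and exhibits `y ^ q` as the inverse of `y`; it is the
  -- form used from here on.
  ∈μ⇔norm≈1 : ∀ y → y * y ^ q ≈ 1# ⇔ y ∈ μ (q ℕ.+ 1)
  ∈μ⇔norm≈1 y = mk⇔ (trans y^[q+1]) (trans (sym y^[q+1]))
    where
    y^[q+1] : y ^ (q ℕ.+ 1) ≈ y * y ^ q
    y^[q+1] = ^-congʳ y (ℕ.+-comm q 1)

  -- Multiplication by x turns the norm of x^(q-1) into x^(q²) = x, and x cancels; no arithmetic
  -- with truncated subtraction is required.
  norm-x^[q∸1] : ∀ {x} → x ≉ 0# → x ^ (q ∸ 1) * (x ^ (q ∸ 1)) ^ q ≈ 1#
  norm-x^[q∸1] {x} x≉0 = *-cancelˡ-≉0 x≉0 (begin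
    x * (y * y ^ q)   ≈⟨ *-assoc x y (y ^ q) ⟨
    x * y * y ^ q     ≈⟨ *-congʳ (x*x^[q∸1]≈x^q x) ⟩
    x ^ q * y ^ q     ≈⟨ conj-* x y ⟨
    (x * y) ^ q       ≈⟨ ^-congˡ q (x*x^[q∸1]≈x^q x) ⟩
    (x ^ q) ^ q       ≈⟨ conj-involutive x ⟩
    x                 ≈⟨ *-identityʳ x ⟨
    x * 1#            ∎)
    where y = x ^ (q ∸ 1)

  -- Hilbert 90 with an explicit witness: for t = y^q + 1, t^q = y + 1 = y (1 + y^q) = y t. This t
  -- vanishes only at y = 1, where t = 1 serves instead.
  norm≈1⇒^[q∸1] : ∀ {y} → y * y ^ q ≈ 1# → ∃[ t ] (t ≉ 0# × t ^ (q ∸ 1) ≈ y)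
  norm≈1⇒^[q∸1] {y} norm≈1 with y ≟ 1#
  ... | yes y≈1 = 1# , 1≉0 , trans (1^n≈1 (q ∸ 1)) (sym y≈1)
  ... | no  y≉1 = t , t≉0 , *-cancelˡ-≉0 t≉0 (begin
    t * t ^ (q ∸ 1)        ≈⟨ x*x^[q∸1]≈x^q t ⟩
    (y ^ q + 1#) ^ q       ≈⟨ conj-+ _ _ ⟩
    (y ^ q) ^ q + 1# ^ q   ≈⟨ +-cong (conj-involutive y) (1^n≈1 q) ⟩
    y + 1#                 ≈⟨ +-congˡ norm≈1 ⟨
    y + y * y ^ q          ≈⟨ solve 2 (λ y w → y :+ y :* w := (w :+ con 1) :* y) refl y (y ^ q) ⟩
    t * y                  ∎)
    where
    t = y ^ q + 1#
    t≉0 : t ≉ 0#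
    t≉0 t≈0 = y≉1 (begin
      y            ≈⟨ *-identityʳ y ⟨
      y * 1#       ≈⟨ *-congˡ (x+y≈0⇒x≈y t≈0) ⟨
      y * y ^ q    ≈⟨ norm≈1 ⟩
      1#           ∎)

  -- Let d be the gcd and q - 1 = k d. For nonzero x in `F` the element x^k has trivial d-th power,
  -- hence trivial s-th and (q-1)-th powers, so it is 1. If d ≥ 2, all q elements of `F` then
  -- satisfy x^(k+1) = x although k + 1 < q.
  trivial-torsion⇒coprime : ∀ s → (∀ u → u ^ s ≈ 1# → u ^ (q ∸ 1) ≈ 1# → u ≈ 1#) → gcd s (q ∸ 1) ≡ 1
  trivial-torsion⇒coprime s trivial = cases (gcd s (q ∸ 1)) (gcd[m,n]∣m s (q ∸ 1)) (gcd[m,n]∣n s (q ∸ 1))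
    where
    0<q∸1 : 0 < q ∸ 1
    0<q∸1 = ℕ.m<n⇒0<n∸m 1<q
    cases : ∀ d → d ∣ s → d ∣ q ∸ 1 → d ≡ 1
    cases 1 _ _ = ≡.refl
    cases 0 _ (divides k q∸1≡kd) = contradiction (≡.trans q∸1≡kd (ℕ.*-zeroʳ k)) (ℕ.m<n⇒n≢0 0<q∸1)
    cases d@(suc (suc _)) (divides j s≡jd) (divides k q∸1≡kd) =
      contradiction fixed (few-fixed-points Fq.element Fq.element-injective (s≤s 0<k) k+1<q)
      where
      0<k : 0 < k
      0<k = ℕ.n≢0⇒n>0 λ k≡0 → ℕ.m<n⇒n≢0 0<q∸1 (≡.trans q∸1≡kd (≡.cong (ℕ._* d) k≡0))
      k+1<q : suc k < q
      k+1<q = ≡.subst (suc k <_) (ℕ.m+[n∸m]≡n 0<q) (s≤s (≡.subst (k <_) (≡.sym q∸1≡kd)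
        (ℕ.m<m*n k d {{ℕ.>-nonZero 0<k}} (s≤s (s≤s z≤n)))))
      fixed : ∀ i → Fq.element i ^ suc k ≈ Fq.element i
      fixed i with Fq.element i ≟ 0#
      ... | yes x≈0 = trans (*-congʳ x≈0) (trans (zeroˡ _) (sym x≈0))
      ... | no  x≉0 = trans (*-congˡ (trivial u
        (trans (^-congʳ u s≡jd) (^*≈1 u j d uᵈ≈1)) (trans (^-congʳ u q∸1≡kd) (^*≈1 u k d uᵈ≈1)))) (*-identityʳ _)
        where
        u = Fq.element i ^ k
        uᵈ≈1 : u ^ d ≈ 1#
        uᵈ≈1 = trans (^-assocʳ _ k d)
          (trans (^-congʳ _ (≡.sym q∸1≡kd)) (Fq.x^[n∸1]≈1 (Fq.element∈F i) x≉0))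

  -- Roots of the trinomial on the unit circle and the trace condition

  module _ {a b : Carrier} (a∉F : a ∉ F) (b∈F : b ∈ F) (b≉0 : b ≉ 0#) where

    private
      A = a ^ q
      i = b ⁻¹
      discriminant = a ^ (q ℕ.+ 1) / b ^ 2

    trinomial : Carrier → Carrier
    trinomial w = A * (w * w) + b * w + a

    trinomial-cong : ∀ {v w} → v ≈ w → trinomial v ≈ trinomial w
    trinomial-cong v≈w = +-congʳ (+-cong (*-congˡ (*-cong v≈w v≈w)) (*-congˡ v≈w))

    a≉0 : a ≉ 0#
    a≉0 a≈0 = a∉F (resp (sym a≈0) 0-closed)

    -- Conjugation exchanges a and a^q, fixes b, and takes y^q back to y.
    conj-trinomial : ∀ y → trinomial (y ^ q) ^ q ≈ a * (y * y) + b * y + A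
    conj-trinomial y = begin
      (A * (w * w) + b * w + a) ^ q                    ≈⟨ trans (conj-+ _ a) (+-congʳ (conj-+ _ _)) ⟩
      (A * (w * w)) ^ q + (b * w) ^ q + A              ≈⟨ +-congʳ (+-cong (trans (conj-* A _) (*-congˡ (conj-* w w))) (conj-* b w)) ⟩
      A ^ q * (w ^ q * w ^ q) + b ^ q * w ^ q + A      ≈⟨ +-congʳ (+-cong (*-cong (conj-involutive a) (*-cong w^q w^q)) (*-cong (F-conj b∈F) w^q)) ⟩
      a * (y * y) + b * y + A                          ∎
      where
      w = y ^ q
      w^q = conj-involutive y

    -- With w = 1/y, the factor y² reverses the coefficients. The right-hand side agrees with that
    -- of `conj-trinomial`, which yields T(y^q)^q = y² T(y^q).
    reciprocal-trinomial : ∀ {y w} → y * w ≈ 1# → y * y * trinomial w ≈ a * (y * y) + b * y + A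
    reciprocal-trinomial {y} {w} yw≈1 = begin
      y * y * (A * (w * w) + b * w + a)
        ≈⟨ solve 5 (λ y w A b a → y :* y :* (A :* (w :* w) :+ b :* w :+ a)
             := a :* (y :* y) :+ b :* y :* (y :* w) :+ A :* ((y :* w) :* (y :* w))) refl y w A b a ⟩
      a * (y * y) + b * y * (y * w) + A * ((y * w) * (y * w))
        ≈⟨ +-cong (+-congˡ (*-congˡ yw≈1)) (*-congˡ (*-cong yw≈1 yw≈1)) ⟩
      a * (y * y) + b * y * 1# + A * (1# * 1#)
        ≈⟨ solve 4 (λ a b y A → a :* (y :* y) :+ b :* y :* con 1 :+ A :* (con 1 :* con 1)
             := a :* (y :* y) :+ b :* y :+ A) refl a b y A ⟩
      a * (y * y) + b * y + A ∎

    bi≈1 : b * i ≈ 1#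
    bi≈1 = *-inverse b≉0

    conj-i : i ^ q ≈ i
    conj-i = F-conj (⁻¹-closed b∈F b≉0)

    discriminant≈ : discriminant ≈ a * A * (i * i)
    discriminant≈ = *-cong (^-congʳ a (ℕ.+-comm q 1)) (sym (⁻¹-unique (begin
      b ^ 2 * (i * i)         ≈⟨ *-congʳ (x^2≈x*x b) ⟩
      b * b * (i * i)         ≈⟨ solve 2 (λ b i → b :* b :* (i :* i) := (b :* i) :* (b :* i)) refl b i ⟩
      b * i * (b * i)         ≈⟨ *-cong bi≈1 bi≈1 ⟩
      1# * 1#                 ≈⟨ *-identityˡ 1# ⟩
      1#                      ∎)))

    -- z = a y / b turns a y² + b y + a^q = 0 into z² + z = a^(q+1) / b², and
    -- y ∈ μ_{q+1} into z^q + z = 1.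
    root⇒Tr≈1 : ∀ {y} → y * y ^ q ≈ 1# → trinomial (y ^ q) ≈ 0# → Tr m discriminant ≈ 1#
    root⇒Tr≈1 {y} yw≈1 root = begin
      Tr m discriminant  ≈⟨ Tr-cong m z²+z ⟨
      Tr m (z * z + z)   ≈⟨ Tr-artin-schreier z ⟩
      z ^ q + z          ≈⟨ x+y≈0⇒x≈y zᑫ+z+1 ⟩
      1#                 ∎
      where
      w = y ^ q
      z = a * y * i
      quadratic : a * (y * y) + b * y + A ≈ 0#
      quadratic = trans (sym (reciprocal-trinomial yw≈1)) (trans (*-congˡ root) (zeroʳ _))
      z²+z : z * z + z ≈ discriminant
      z²+z = x+y≈0⇒x≈y (begin
        z * z + z + discriminant
          ≈⟨ +-cong (+-congˡ (sym (trans (*-congˡ bi≈1) (*-identityʳ z)))) discriminant≈ ⟩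
        z * z + z * (b * i) + a * A * (i * i)
          ≈⟨ solve 5 (λ a y i b A → (a :* y :* i) :* (a :* y :* i) :+ a :* y :* i :* (b :* i) :+ a :* A :* (i :* i)
               := a :* i :* i :* (a :* (y :* y) :+ b :* y :+ A)) refl a y i b A ⟩
        a * i * i * (a * (y * y) + b * y + A)
          ≈⟨ *-congˡ quadratic ⟩
        a * i * i * 0#
          ≈⟨ zeroʳ _ ⟩
        0# ∎)
      zᑫ : z ^ q ≈ A * w * i
      zᑫ = trans (conj-* (a * y) i) (*-cong (conj-* a y) conj-i)
      zᑫ+z+1 : z ^ q + z + 1# ≈ 0#
      zᑫ+z+1 = begin
        z ^ q + z + 1#
          -- The factors `y * w` and `b * i`, both equal to 1, are inserted so that the quadratic
          -- can be factored out.
          ≈⟨ +-cong (+-cong zᑫ (sym (trans (*-congˡ yw≈1) (*-identityʳ z)))) (sym (trans (*-cong yw≈1 bi≈1) (*-identityˡ 1#))) ⟩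
        A * w * i + z * (y * w) + y * w * (b * i)
          ≈⟨ solve 6 (λ A w i a y b → A :* w :* i :+ a :* y :* i :* (y :* w) :+ y :* w :* (b :* i)
               := w :* i :* (a :* (y :* y) :+ b :* y :+ A)) refl A w i a y b ⟩
        w * i * (a * (y * y) + b * y + A)
          ≈⟨ *-congˡ quadratic ⟩
        w * i * 0#
          ≈⟨ zeroʳ _ ⟩
        0# ∎

    -- z₀ = a / (a + a^q) satisfies z₀^q + z₀ = 1, so d = z₀² + z₀ has trace 1.
    trace-one-element : ∃[ z ] Tr m (z * z + z) ≈ 1#
    trace-one-element = z , (begin
      Tr m (z * z + z)  ≈⟨ Tr-artin-schreier z ⟩
      z ^ q + z         ≈⟨ +-congʳ (trans (conj-* a j) (*-congˡ conj-j)) ⟩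
      A * j + a * j     ≈⟨ distribʳ j A a ⟨
      (A + a) * j       ≈⟨ *-inverse A+a≉0 ⟩
      1#                ∎)
      where
      -- Since a lies outside `F`, a^q differs from a.
      A+a≉0 : A + a ≉ 0#
      A+a≉0 A+a≈0 = ∉F-conj a∉F (x+y≈0⇒x≈y A+a≈0)
      j = (A + a) ⁻¹
      z = a * j
      -- Conjugation swaps the summands of a^q + a, so it fixes the sum and its inverse.
      conj-j : j ^ q ≈ j
      conj-j = trans (conj-⁻¹ A+a≉0)
        (⁻¹-cong (trans (conj-+ A a) (trans (+-congʳ (conj-involutive a)) (+-comm a A))))

    -- With d = z₀² + z₀ of trace 1, e + d has trace 0, and `artin-schreier` reduces to w² + w = e +
    -- d. Adding z₀ to w then removes d.
    artin-schreier-shift : ∀ {e} z₀ → Tr m (z₀ * z₀ + z₀) ≈ 1# → Tr m e ≈ 1# → ∃[ z ] z * z + z ≈ e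
    artin-schreier-shift {e} z₀ Tr-d Tr-e = let w , w²+w = artin-schreier m d (e + d) in z₀ + w , (begin
      (z₀ + w) * (z₀ + w) + (z₀ + w)
        ≈⟨ solve 2 (λ z w → (z :+ w) :* (z :+ w) :+ (z :+ w)
             := z :* z :+ z :+ (w :* w :+ w) :+ (z :* w :+ z :* w)) refl z₀ w ⟩
      z₀ * z₀ + z₀ + (w * w + w) + (z₀ * w + z₀ * w)
        ≈⟨ x+[y+y]≈x _ _ ⟩
      z₀ * z₀ + z₀ + (w * w + w)
        ≈⟨ +-congˡ w²+w ⟩
      d + (Tr m (e + d) * D + (e + d) * (Tr m d * Tr m d))
        ≈⟨ +-congˡ (+-cong (*-congʳ Tr[e+d]≈0) (*-congˡ (*-cong Tr-d Tr-d))) ⟩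
      d + (0# * D + (e + d) * (1# * 1#))
        ≈⟨ solve 3 (λ d D e → d :+ (con 0 :* D :+ (e :+ d) :* (con 1 :* con 1)) := e :+ (d :+ d)) refl d D e ⟩
      e + (d + d)
        ≈⟨ x+[y+y]≈x e d ⟩
      e ∎)
      where
      d = z₀ * z₀ + z₀
      D = d ^ (2 ℕ.^ m)
      Tr[e+d]≈0 : Tr m (e + d) ≈ 0#
      Tr[e+d]≈0 = trans (Tr-+ m e d) (trans (+-cong Tr-e Tr-d) 1+1≈0)

    -- The substitution is reversed by y = b z / a. The trace gives z^q = z + 1, the other root of
    -- the same equation; hence y has norm b² (z² + z) / a^(q+1) = 1, and T(y^q) reduces to the
    -- equation for z^q.
    artin-schreier⇒root : ∀ z → z * z + z ≈ discriminant → Tr m discriminant ≈ 1# →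
      ∃[ y ] (y * y ^ q ≈ 1# × trinomial (y ^ q) ≈ 0#)
    artin-schreier⇒root z z²+z Tr≈1 = y , norm≈1 , (begin
      A * (w * w) + b * w + a
        ≈⟨ +-congʳ (+-cong (*-congˡ (*-cong wᵢ wᵢ)) (*-congˡ wᵢ)) ⟩
      A * (b * z′ * A⁻¹ * (b * z′ * A⁻¹)) + b * (b * z′ * A⁻¹) + a
        ≈⟨ solve 5 (λ A A⁻¹ b z′ a → A :* (b :* z′ :* A⁻¹ :* (b :* z′ :* A⁻¹)) :+ b :* (b :* z′ :* A⁻¹) :+ a
             := b :* b :* (z′ :* z′ :* (A :* A⁻¹) :+ z′) :* A⁻¹ :+ a) refl A A⁻¹ b z′ a ⟩
      b * b * (z′ * z′ * (A * A⁻¹) + z′) * A⁻¹ + a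
        ≈⟨ +-congʳ (*-congʳ (*-congˡ (trans (+-congʳ (trans (*-congˡ AA⁻¹) (*-identityʳ _))) z′²+z′))) ⟩
      b * b * (a * A * (i * i)) * A⁻¹ + a
        ≈⟨ solve 5 (λ b a A i A⁻¹ → b :* b :* (a :* A :* (i :* i)) :* A⁻¹ :+ a
             := (b :* i) :* (b :* i) :* (A :* A⁻¹) :* a :+ a) refl b a A i A⁻¹ ⟩
      b * i * (b * i) * (A * A⁻¹) * a + a
        ≈⟨ +-congʳ (*-congʳ (*-cong (*-cong bi≈1 bi≈1) AA⁻¹)) ⟩
      1# * 1# * 1# * a + a
        ≈⟨ solve 1 (λ a → con 1 :* con 1 :* con 1 :* a :+ a := a :+ a) refl a ⟩
      a + a
        ≈⟨ x+x≈0 a ⟩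
      0# ∎)
      where
      A⁻¹ = A ⁻¹
      z′ = z ^ q
      y = b * z * a ⁻¹
      w = y ^ q
      AA⁻¹ : A * A⁻¹ ≈ 1#
      AA⁻¹ = *-inverse (^-≉0 q a≉0)
      wᵢ : w ≈ b * z′ * A⁻¹
      wᵢ = trans (conj-* (b * z) (a ⁻¹)) (*-cong (trans (conj-* b z) (*-congʳ (F-conj b∈F))) (conj-⁻¹ a≉0))
      z′≈z+1 : z′ ≈ z + 1#
      z′≈z+1 = begin
        z′                ≈⟨ x+[y+y]≈x z′ z ⟨
        z′ + (z + z)      ≈⟨ +-assoc z′ z z ⟨
        z′ + z + z        ≈⟨ +-congʳ (Tr-artin-schreier z) ⟨
        Tr m (z * z + z) + z ≈⟨ +-congʳ (trans (Tr-cong m z²+z) Tr≈1) ⟩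
        1# + z            ≈⟨ +-comm 1# z ⟩
        z + 1#            ∎
      z²+z≈ : z * z + z ≈ a * A * (i * i)
      z²+z≈ = trans z²+z discriminant≈
      z′²+z′ : z′ * z′ + z′ ≈ a * A * (i * i)
      z′²+z′ = begin
        z′ * z′ + z′                    ≈⟨ +-cong (*-cong z′≈z+1 z′≈z+1) z′≈z+1 ⟩
        (z + 1#) * (z + 1#) + (z + 1#)  ≈⟨ solve 1 (λ z → (z :+ con 1) :* (z :+ con 1) :+ (z :+ con 1)
                                            := z :* z :+ z :+ ((z :+ con 1) :+ (z :+ con 1))) refl z ⟩
        z * z + z + ((z + 1#) + (z + 1#)) ≈⟨ x+[y+y]≈x _ _ ⟩
        z * z + z                       ≈⟨ z²+z≈ ⟩
        a * A * (i * i)                 ∎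
      norm≈1 : y * w ≈ 1#
      norm≈1 = begin
        y * w
          ≈⟨ *-congˡ (trans wᵢ (*-congʳ (*-congˡ z′≈z+1))) ⟩
        b * z * a ⁻¹ * (b * (z + 1#) * A⁻¹)
          ≈⟨ solve 4 (λ b z α β → b :* z :* α :* (b :* (z :+ con 1) :* β)
               := b :* b :* (z :* z :+ z) :* (α :* β)) refl b z (a ⁻¹) A⁻¹ ⟩
        b * b * (z * z + z) * (a ⁻¹ * A⁻¹)
          ≈⟨ *-congʳ (*-congˡ z²+z≈) ⟩
        b * b * (a * A * (i * i)) * (a ⁻¹ * A⁻¹)
          ≈⟨ solve 6 (λ b a A i α β → b :* b :* (a :* A :* (i :* i)) :* (α :* β)
               := (b :* i) :* (b :* i) :* (a :* α) :* (A :* β)) refl b a A i (a ⁻¹) A⁻¹ ⟩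
        b * i * (b * i) * (a * a ⁻¹) * (A * A⁻¹)
          ≈⟨ *-cong (*-cong (*-cong bi≈1 bi≈1) (*-inverse a≉0)) AA⁻¹ ⟩
        1# * 1# * 1# * 1#
          ≈⟨ solve 0 (con 1 :* con 1 :* con 1 :* con 1 := con 1) refl ⟩
        1# ∎

    Tr≈1⇒root : Tr m discriminant ≈ 1# → ∃[ y ] (y * y ^ q ≈ 1# × trinomial (y ^ q) ≈ 0#)
    Tr≈1⇒root Tr≈1 =
      let z₀ , Tr-z₀ = trace-one-element
          z , z²+z = artin-schreier-shift z₀ Tr-z₀ Tr≈1
      in artin-schreier⇒root z z²+z Tr≈1

    -- The polynomial map and its conjugate

    module _ (r s : ℕ) (0<s : 0 < s) (s≡r+2q : s % suc q ≡ (r ℕ.+ 2 ℕ.* q) % suc q)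
      (B : Polynomial) (B≉0 : ∀ x → x ∈ μ (q ℕ.+ 1) → eval B x ≉ 0#) where

      f : Carrier → Carrier
      f x = x ^ s * eval B (x ^ (q ∸ 1)) * (a ^ q * x ^ (2 ℕ.* q ℕ.* (q ∸ 1)) + b * x ^ (q ℕ.* (q ∸ 1)) + a)

      G : Carrier → Carrier
      G y = y ^ r * eval (conjugate q B) (1# / y) / eval B y

      -- The part of `f` that depends on x only through y = x^(q-1); the other factor is x^s.
      h : Carrier → Carrier
      h y = eval B y * trinomial (y ^ q)

      h-cong : ∀ {x y} → x ≈ y → h x ≈ h y
      h-cong x≈y = *-cong (eval-cong B x≈y) (trinomial-cong (^-congˡ q x≈y))

      f≈ : ∀ x → f x ≈ x ^ s * h (x ^ (q ∸ 1))
      f≈ x = trans (*-assoc _ _ _) (*-congˡ (*-congˡ (+-congʳ (+-cong (*-congˡ x^2q[q∸1]) (*-congˡ x^q[q∸1])))))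
        where
        y = x ^ (q ∸ 1)
        x^q[q∸1] : x ^ (q ℕ.* (q ∸ 1)) ≈ y ^ q
        x^q[q∸1] = trans (^-congʳ x (ℕ.*-comm q (q ∸ 1))) (sym (^-assocʳ x (q ∸ 1) q))
        x^2q[q∸1] : x ^ (2 ℕ.* q ℕ.* (q ∸ 1)) ≈ y ^ q * y ^ q
        x^2q[q∸1] = begin
          x ^ (2 ℕ.* q ℕ.* (q ∸ 1))     ≈⟨ ^-congʳ x (≡.trans (ℕ.*-assoc 2 q (q ∸ 1)) (ℕ.*-comm 2 (q ℕ.* (q ∸ 1)))) ⟩
          x ^ (q ℕ.* (q ∸ 1) ℕ.* 2)     ≈⟨ ^-assocʳ x (q ℕ.* (q ∸ 1)) 2 ⟨
          (x ^ (q ℕ.* (q ∸ 1))) ^ 2     ≈⟨ x^2≈x*x _ ⟩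
          _                             ≈⟨ *-cong x^q[q∸1] x^q[q∸1] ⟩
          y ^ q * y ^ q                 ∎

      f-cong : ∀ {x y} → x ≈ y → f x ≈ f y
      f-cong {x} {y} x≈y = begin
        f x                       ≈⟨ f≈ x ⟩
        x ^ s * h (x ^ (q ∸ 1))   ≈⟨ *-cong (^-congˡ s x≈y) (h-cong (^-congˡ (q ∸ 1) x≈y)) ⟩
        y ^ s * h (y ^ (q ∸ 1))   ≈⟨ f≈ y ⟨
        f y                       ∎

      f-≈0 : ∀ {x} → x ≈ 0# → f x ≈ 0#
      -- Positivity of s matters, because `0# ^ 0` is 1.
      f-≈0 {x} x≈0 = trans (f≈ x) (trans (*-congʳ (trans (^-congˡ s x≈0) (0^n≈0 0<s))) (zeroˡ _))

      -- Exponents of `y` count modulo q + 1, and (r + 2q) + 2 = r + 2(q + 1).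
      y^s*y²≈y^r : ∀ {y} → y * y ^ q ≈ 1# → y ^ s * (y * y) ≈ y ^ r
      y^s*y²≈y^r {y} norm≈1 = begin
        y ^ s * (y * y)                      ≈⟨ *-congʳ (^-%-cong (suc q) s (r ℕ.+ 2 ℕ.* q) norm≈1 s≡r+2q) ⟩
        y ^ (r ℕ.+ 2 ℕ.* q) * (y * y)        ≈⟨ *-congʳ (^-homo-* y r (2 ℕ.* q)) ⟩
        y ^ r * y ^ (2 ℕ.* q) * (y * y)      ≈⟨ *-congʳ (*-congˡ (trans (^-congʳ y (ℕ.*-comm 2 q)) (trans (sym (^-assocʳ y q 2)) (x^2≈x*x _)))) ⟩
        y ^ r * (y ^ q * y ^ q) * (y * y)    ≈⟨ solve 3 (λ c w y → c :* (w :* w) :* (y :* y) := c :* ((y :* w) :* (y :* w))) refl (y ^ r) (y ^ q) y ⟩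
        y ^ r * (y * y ^ q * (y * y ^ q))    ≈⟨ *-congˡ (trans (*-cong norm≈1 norm≈1) (*-identityˡ 1#)) ⟩
        y ^ r * 1#                           ≈⟨ *-identityʳ _ ⟩
        y ^ r                                ∎

      -- f(x)^(q-1) = G(x^(q-1)) with the denominator f(x), which may vanish, cleared.
      f^q≈G*f : ∀ {x} → x ≉ 0# → f x ^ q ≈ G (x ^ (q ∸ 1)) * f x
      f^q≈G*f {x} x≉0 = begin
        f x ^ q
          ≈⟨ trans (^-congˡ q (f≈ x)) (trans (conj-* _ _) (*-congˡ (conj-* _ _))) ⟩
        (x ^ s) ^ q * (eval B y ^ q * trinomial (y ^ q) ^ q)
          ≈⟨ *-cong conj-x^s (*-cong (conj-eval B y^q≈1/y)
               (trans (conj-trinomial y) (sym (reciprocal-trinomial norm≈1)))) ⟩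
        x ^ s * y ^ s * (β′ * (y * y * t))
          ≈⟨ solve 5 (λ X Y β y t → X :* Y :* (β :* (y :* y :* t)) := Y :* (y :* y) :* β :* (X :* t)) refl (x ^ s) (y ^ s) β′ y t ⟩
        y ^ s * (y * y) * β′ * (x ^ s * t)
          ≈⟨ *-congʳ (*-congʳ (y^s*y²≈y^r norm≈1)) ⟩
        y ^ r * β′ * (x ^ s * t)
          -- Inserting `β * β ⁻¹` supplies both the denominator of `G` and the factor `eval B y` of
          -- `h`.
          ≈⟨ *-congˡ (trans (sym (*-identityˡ _)) (*-congʳ (sym (*-inverse β≉0)))) ⟩
        y ^ r * β′ * (β * β ⁻¹ * (x ^ s * t))
          ≈⟨ solve 5 (λ c β β⁻¹ X t → c :* (β :* β⁻¹ :* (X :* t)) := c :* β⁻¹ :* (X :* (β :* t))) refl (y ^ r * β′) β (β ⁻¹) (x ^ s) t ⟩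
        G y * (x ^ s * h y)
          ≈⟨ *-congˡ (f≈ x) ⟨
        G y * f x ∎
        where
        y = x ^ (q ∸ 1)
        norm≈1 = norm-x^[q∸1] x≉0
        β = eval B y
        β≉0 : β ≉ 0#
        β≉0 = B≉0 y (Equivalence.to (∈μ⇔norm≈1 y) norm≈1)
        β′ = eval (conjugate q B) (1# / y)
        t = trinomial (y ^ q)
        y^q≈1/y : y ^ q ≈ 1# / y
        y^q≈1/y = trans (⁻¹-unique norm≈1) (sym (*-identityˡ _))
        conj-x^s : (x ^ s) ^ q ≈ x ^ s * y ^ s
        conj-x^s = begin
          (x ^ s) ^ q    ≈⟨ trans (^-assocʳ x s q) (trans (^-congʳ x (ℕ.*-comm s q)) (sym (^-assocʳ x q s))) ⟩
          (x ^ q) ^ s    ≈⟨ ^-congˡ s (x*x^[q∸1]≈x^q x) ⟨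
          (x * y) ^ s    ≈⟨ ^-distrib-* x y s ⟩
          x ^ s * y ^ s  ∎

      -- Necessity of the two conditions

      injective⇒coprime : Injective _≈_ _≈_ f → gcd s (q ∸ 1) ≡ 1
      -- The value `f x` depends only on x^s and x^(q-1), so such a `u` collides with 1.
      injective⇒coprime inj = trivial-torsion⇒coprime s λ u uˢ≈1 u^[q∸1]≈1 → inj (begin
        f u                         ≈⟨ f≈ u ⟩
        u ^ s * h (u ^ (q ∸ 1))     ≈⟨ *-cong (trans uˢ≈1 (sym (1^n≈1 s))) (h-cong (trans u^[q∸1]≈1 (sym (1^n≈1 (q ∸ 1))))) ⟩
        1# ^ s * h (1# ^ (q ∸ 1))   ≈⟨ f≈ 1# ⟨
        f 1#                        ∎)

      -- Hilbert 90 lifts a root y to a nonzero t with t^(q-1) = y, and f sends both t and 0 to 0.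
      injective⇒no-root : Injective _≈_ _≈_ f → ∀ {y} → y * y ^ q ≈ 1# → trinomial (y ^ q) ≉ 0#
      injective⇒no-root inj norm≈1 root =
        let t , t≉0 , t^[q∸1]≈y = norm≈1⇒^[q∸1] norm≈1
        in t≉0 (inj (begin
          f t                         ≈⟨ f≈ t ⟩
          t ^ s * h (t ^ (q ∸ 1))     ≈⟨ *-congˡ (trans (h-cong t^[q∸1]≈y) (trans (*-congˡ root) (zeroʳ _))) ⟩
          t ^ s * 0#                  ≈⟨ zeroʳ _ ⟩
          0#                          ≈⟨ f-≈0 refl ⟨
          f 0#                        ∎))

      -- Sufficiency of the two conditions

      module _ (G-injective : ∀ {x y} → x ∈ μ (q ℕ.+ 1) → y ∈ μ (q ℕ.+ 1) → G x ≈ G y → x ≈ y)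
        (coprime : gcd s (q ∸ 1) ≡ 1) (no-root : ∀ {y} → y * y ^ q ≈ 1# → trinomial (y ^ q) ≉ 0#) where

        h-≉0 : ∀ {x} → x ≉ 0# → h (x ^ (q ∸ 1)) ≉ 0#
        h-≉0 x≉0 = *-≉0 (B≉0 _ (Equivalence.to (∈μ⇔norm≈1 _) norm≈1)) (no-root norm≈1)
          where norm≈1 = norm-x^[q∸1] x≉0

        f-≉0 : ∀ {x} → x ≉ 0# → f x ≉ 0#
        f-≉0 {x} x≉0 fx≈0 = *-≉0 (^-≉0 s x≉0) (h-≉0 x≉0) (trans (sym (f≈ x)) fx≈0)

        -- Cancelling the common value of `f` leaves G(u) = G(v), hence u = v; cancelling `h u` then
        -- leaves equal s-th powers, and coprimality of the exponents finishes.
        f-injective-≉0 : ∀ {x y} → x ≉ 0# → y ≉ 0# → f x ≈ f y → x ≈ y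
        f-injective-≉0 {x} {y} x≉0 y≉0 fx≈fy =
          coprime-powers-injective s (q ∸ 1) coprime y≉0 x^s≈y^s x^[q∸1]≈y^[q∸1]
          where
          u = x ^ (q ∸ 1)
          v = y ^ (q ∸ 1)
          x^[q∸1]≈y^[q∸1] : u ≈ v
          x^[q∸1]≈y^[q∸1] = G-injective
            (Equivalence.to (∈μ⇔norm≈1 u) (norm-x^[q∸1] x≉0)) (Equivalence.to (∈μ⇔norm≈1 v) (norm-x^[q∸1] y≉0))
            (*-cancelˡ-≉0 (f-≉0 x≉0) (begin
              f x * G u   ≈⟨ *-comm _ _ ⟩
              G u * f x   ≈⟨ f^q≈G*f x≉0 ⟨
              f x ^ q     ≈⟨ ^-congˡ q fx≈fy ⟩
              f y ^ q     ≈⟨ f^q≈G*f y≉0 ⟩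
              G v * f y   ≈⟨ *-congˡ fx≈fy ⟨
              G v * f x   ≈⟨ *-comm _ _ ⟩
              f x * G v   ∎))
          x^s≈y^s : x ^ s ≈ y ^ s
          x^s≈y^s = *-cancelˡ-≉0 (h-≉0 x≉0) (begin
            h u * x ^ s   ≈⟨ *-comm _ _ ⟩
            x ^ s * h u   ≈⟨ f≈ x ⟨
            f x           ≈⟨ fx≈fy ⟩
            f y           ≈⟨ f≈ y ⟩
            y ^ s * h v   ≈⟨ *-comm _ _ ⟩
            h v * y ^ s   ≈⟨ *-congʳ (h-cong x^[q∸1]≈y^[q∸1]) ⟨
            h u * y ^ s   ∎)

        f-injective : Injective _≈_ _≈_ f
        f-injective {x} {y} fx≈fy with x ≟ 0# | y ≟ 0#
        ... | yes x≈0 | yes y≈0 = trans x≈0 (sym y≈0)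
        ... | yes x≈0 | no  y≉0 = contradiction (trans (sym fx≈fy) (f-≈0 x≈0)) (f-≉0 y≉0)
        ... | no  x≉0 | yes y≈0 = contradiction (trans fx≈fy (f-≈0 y≈0)) (f-≉0 x≉0)
        ... | no  x≉0 | no  y≉0 = f-injective-≉0 x≉0 y≉0 fx≈fy

      -- Surjectivity comes from the finiteness of `K`; closure under `U` is trivial.
      injective⇒permutes : Injective _≈_ _≈_ f → Permutes f U
      injective⇒permutes inj = _ , inj , surjective
        where
        surjective : ∀ v → ∃[ u ] (∀ {z} → proj₁ z ≈ proj₁ u → f (proj₁ z) ≈ proj₁ v)
        surjective (v , _) = let u , fu≈v = injective⇒surjective inj v
          in (u , tt) , λ z≈u → trans (f-cong z≈u) fu≈v

      permutes⇔ : Permutes G (μ (q ℕ.+ 1)) →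
        Permutes f U ⇔ (gcd s (q ∸ 1) ≡ 1 × Tr m discriminant ≉ 1#)
      permutes⇔ (_ , G-inj , _) = mk⇔
        (λ (_ , f-inj , _) →
          let inj : Injective _≈_ _≈_ f
              inj = λ {x} {y} → f-inj {x , tt} {y , tt}
          in injective⇒coprime inj , λ Tr≈1 →
            let y , norm≈1 , root = Tr≈1⇒root Tr≈1 in injective⇒no-root inj norm≈1 root)
        (λ (coprime , Tr≉1) → injective⇒permutes (f-injective
          (λ x∈μ y∈μ → G-inj {_ , x∈μ} {_ , y∈μ}) coprime
          (λ norm≈1 root → Tr≉1 (root⇒Tr≈1 norm≈1 root))))

theorem3p9 : ∀ {c ℓ p} (m q : ℕ) → 1 ≤ m → q ≡ 2 ℕ.^ m →
    (K : Field c ℓ) → let open Field K in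
    HasCardinality setoid (q ℕ.^ 2) →
    (F : Pred Carrier p) → IsSubfield F → HasCardinality (subsetoid F) q →
    (r s : ℕ) → 0 < r → 0 < s →
    s % (ℕ.suc q) ≡ (r ℕ.+ 2 ℕ.* q) % (ℕ.suc q) →
    (B : Polynomial) →
    (∀ x → x ∈ μ (q ℕ.+ 1) → eval B x ≉ 0#) →
    Permutes (λ x → x ^ r * eval (conjugate q B) (1# / x) / eval B x) (μ (q ℕ.+ 1)) →
    (a b : Carrier) → a ∉ F → b ∈ F → b ≉ 0# →
    Permutes (λ x → x ^ s * eval B (x ^ (q ∸ 1)) * (a ^ q * x ^ (2 ℕ.* q ℕ.* (q ∸ 1)) + b * x ^ (q ℕ.* (q ∸ 1)) + a)) U
    ⇔ (gcd s (q ∸ 1) ≡ 1 × Tr m (a ^ (q ℕ.+ 1) / b ^ 2) ≉ 1#)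
theorem3p9 m q 1≤m q≡2^m K K-finite F F-isSubfield F-finite r s _ 0<s s≡r+2q B B≉0 G-permutes a b a∉F b∈F b≉0 =
  permutes⇔ a∉F b∈F b≉0 r s 0<s s≡r+2q B B≉0 G-permutes
  where open QuadraticExtension m q 1≤m q≡2^m K K-finite F F-isSubfield F-finite
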